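{- For $m\ge 1$ and $1\le a\le m-1$, \begin{align*} &\sum_{N_1,\ldots,N_{m}\ge 0}\frac{q^{\sum_{i=1}^m \binom{N_i+1}{2}}}{(q;q)_{N_1}} \begin{bmatrix}N_1\\ N_2\end{bmatrix}\cdots \begin{bmatrix}N_{a-1}\\ N_{a}\end{bmatrix} \begin{bmatrix}N_a+1\\ N_{a+1}\end{bmatrix} \begin{bmatrix}N_{a+1}\\ N_{a+2}\end{bmatrix}\cdots \begin{bmatrix}N_{m-1}\\ N_{m}\end{bmatrix}\\ &= \sum_{N_1,\ldots,N_{m}\ge 0}\frac{q^{ \sum_{i=1}^m \binom{N_i+1}{2}}}{(q;q)_{N_1}} \begin{bmatrix}N_1\\ N_2\end{bmatrix}\cdots \begin{bmatrix}N_{m-a-1}\\ N_{m-a}\end{bmatrix} \begin{bmatrix}N_{m-a}+1\\ N_{m-a+1}\end{bmatrix} \begin{bmatrix}N_{m-a+1}\\ N_{m-a+2}\end{bmatrix}\cdots \begin{bmatrix}N_{m-1}\\ N_{m}\end{bmatrix}. \end{align*} That is, the sum with exactly one $q$-binomial factor of the form $\begin{bmatrix}N_j+1\\ N_{j+1}\end{bmatrix}$ (and all others $\begin{bmatrix}N_i\\ N_{i+1}\end{bmatrix}$) takes the same value for $j=a$ and $j=m-a$.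
   Context: $(q;q)_n=\prod_{j=1}^{n}(1-q^j)$; $\begin{bmatrix} N\\ M\end{bmatrix}=\frac{(q;q)_N}{(q;q)_M(q;q)_{N-M}}$ for $0\le M\le N$ and $0$ otherwise. -}

module Defs where

open import Data.Nat using (ℕ; zero; suc; _+_; _∸_; _≤?_; _≟_)
open import Data.Integer using (ℤ; +_; -_) renaming (_+_ to _+ℤ_; _*_ to _*ℤ_; _-_ to _-ℤ_)
open import Data.List using (List; []; _∷_; map; concatMap; foldr)
open import Data.Vec using (Vec; []; _∷_)
open import Relation.Nullary using (does)
open import Data.Bool using (if_then_else_)

-- Formal power series in q over ℤ, as coefficient sequences.
FPS : Set
FPS = ℕ → ℤ

sumTo : ℕ → (ℕ → ℤ) → ℤ
sumTo zero    f = f 0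
sumTo (suc n) f = sumTo n f +ℤ f (suc n)

_⊛_ : FPS → FPS → FPS
(f ⊛ g) n = sumTo n (λ k → f k *ℤ g (n ∸ k))
infixl 7 _⊛_

zeroS : FPS
zeroS _ = + 0

qpow : ℕ → FPS
qpow e n = if does (n ≟ e) then + 1 else + 0

oneS : FPS
oneS = qpow 0

qPoch : ℕ → FPS
qPoch zero    = oneS
qPoch (suc j) = qPoch j ⊛ (λ n → oneS n -ℤ qpow (suc j) n)

-- Multiplicative inverse of a power series with constant term 1:
-- b_0 = 1, b_{n+1} = - Σ_{k=0}^{n} a_{n+1-k} b_k.
-- invUpTo a n k is b_k for k ≤ n.
invUpTo : FPS → ℕ → ℕ → ℤ
invUpTo a zero    k = + 1
invUpTo a (suc n) k =
  if does (k ≤? n) then invUpTo a n k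
  else - sumTo n (λ i → a (suc n ∸ i) *ℤ invUpTo a n i)

inv : FPS → FPS
inv a n = invUpTo a n n

qbin : ℕ → ℕ → FPS
qbin N M = if does (M ≤? N)
           then qPoch N ⊛ inv (qPoch M) ⊛ inv (qPoch (N ∸ M))
           else zeroS

tri : ℕ → ℕ
tri zero    = 0
tri (suc n) = suc n + tri n

δ : ℕ → ℕ → ℕ
δ i a = if does (i ≟ a) then 1 else 0

-- ∏_{i} [N_i + δ(i,a) over N_{i+1}], with i the (1-based) index of the first entry
chain : ∀ {k} → ℕ → ℕ → Vec ℕ k → FPS
chain a i (x ∷ y ∷ rest) = qbin (x + δ i a) y ⊛ chain a (suc i) (y ∷ rest)
chain a i _              = oneS

sumTri : ∀ {k} → Vec ℕ k → ℕ
sumTri []       = 0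
sumTri (x ∷ xs) = tri x + sumTri xs

firstInv : ∀ {k} → Vec ℕ k → FPS
firstInv []      = oneS
firstInv (x ∷ _) = inv (qPoch x)

term : ℕ → ∀ {m} → Vec ℕ m → FPS
term a N = qpow (sumTri N) ⊛ firstInv N ⊛ chain a 1 N

range : ℕ → List ℕ
range zero    = 0 ∷ []
range (suc b) = suc b ∷ range b

tuples : (m b : ℕ) → List (Vec ℕ m)
tuples zero    b = [] ∷ []
tuples (suc m) b = concatMap (λ x → map (x ∷_) (tuples m b)) (range b)

-- Coefficient of q^n in Σ_{N_1,…,N_m ≥ 0} term.  Any summand with some N_i > n
-- is divisible by q^{tri N_i}, tri N_i ≥ N_i > n, so its q^n coefficient is 0;
-- hence restricting to N_i ≤ n gives the exact coefficient of the formal sum.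
S : (m a : ℕ) → FPS
S m a n = foldr _+ℤ_ (+ 0) (map (λ N → term a N n) (tuples m n))

{-# OPTIONS --safe #-}
module Submission where

-- Work in ℤ[[q]] modulo q^(n+1).  Let T f N = Σ_M q^(M(M+1)/2) [N,M] f(M), and let
-- U f be its N → ∞ analogue, with [N,M] replaced by 1/(q;q)_M.  The sum with the
-- shifted factor at place a is U T^(a-1) Δ T^(m-a) 1, where Δ f N = f (N+1).
-- Write functions of N as series in z = q^N.  There Δ is diagonal, and by the
-- q-binomial theorem and Euler's expansions of (-zq;q)_∞ and its inverse,
--   T z^k = (-q^(k+1);q)_N = (-q^(k+1);q)_∞ Σ_j (-1)^j q^j q^(jk) z^j / (q;q)_j .
-- The matrix of T is thus the symmetric matrix (q^(jk)) up to row and column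
-- factors, so T is self-adjoint for a diagonal bilinear form, for which U is the
-- pairing with a multiple of T 1.  Taking adjoints exchanges a and m - a.

open import Defs
open import Data.Nat using (ℕ; _≤_; _∸_)
open import Relation.Binary.PropositionalEquality as ≡ using (_≡_; _≢_)
open import Data.Nat as ℕ using (zero; suc; _<_; z≤n; s≤s; _≟_; _≤?_)
import Data.Nat.Properties as ℕ
open import Data.Nat.GeneralisedArithmetic using (fold)
open import Data.Nat.Tactic.RingSolver using (solve-∀)
open import Data.Integer using (ℤ; +_) renaming (_+_ to _+ℤ_; _*_ to _*ℤ_; -_ to -ℤ_)
import Data.Integer.Properties as ℤ
import Data.Integer.Tactic.RingSolver as ℤ
open import Data.List using (List; []; _∷_; _++_; map; foldr; concatMap)
open import Data.Vec using (Vec; []; _∷_)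
open import Data.Product using (_,_)
open import Data.Sum using (inj₁; inj₂)
open import Relation.Nullary.Decidable using (dec-true; dec-false)
open import Relation.Binary.Definitions using (tri<; tri≈; tri>)
open import Algebra.Bundles using (CommutativeRing)
import Algebra.Properties.Semiring.Exp as Exp
import Algebra.Properties.Group as GroupProperties
import Algebra.Properties.Ring as RingProperties
import Algebra.Solver.Ring.NaturalCoefficients.Default as SemiringSolver
open import Level using (0ℓ; _⊔_)

-- Finite sums in a commutative ring

module ListSum {c ℓ} (R : CommutativeRing c ℓ) where
  open CommutativeRing R
  open import Relation.Binary.Reasoning.Setoid setoid
  open SemiringSolver commutativeSemiring

  ∑ : ∀ {a} {A : Set a} → List A → (A → Carrier) → Carrier
  ∑ []       f = 0#
  ∑ (x ∷ xs) f = f x + ∑ xs f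

  ∑-cong : ∀ {a} {A : Set a} (xs : List A) {f g : A → Carrier} →
           (∀ x → f x ≈ g x) → ∑ xs f ≈ ∑ xs g
  ∑-cong []       f≈g = refl
  ∑-cong (x ∷ xs) f≈g = +-cong (f≈g x) (∑-cong xs f≈g)

  ∑-zero : ∀ {a} {A : Set a} (xs : List A) → ∑ xs (λ _ → 0#) ≈ 0#
  ∑-zero []       = refl
  ∑-zero (x ∷ xs) = trans (+-identityˡ _) (∑-zero xs)

  ∑-+ : ∀ {a} {A : Set a} (xs : List A) (f g : A → Carrier) →
        ∑ xs (λ x → f x + g x) ≈ ∑ xs f + ∑ xs g
  ∑-+ []       f g = sym (+-identityˡ 0#)
  ∑-+ (x ∷ xs) f g = trans (+-congˡ (∑-+ xs f g))
    (solve 4 (λ a b s t → (a :+ b) :+ (s :+ t) := (a :+ s) :+ (b :+ t)) refl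
      (f x) (g x) (∑ xs f) (∑ xs g))

  *-∑ : ∀ {a} {A : Set a} (xs : List A) y (f : A → Carrier) →
        y * ∑ xs f ≈ ∑ xs (λ x → y * f x)
  *-∑ []       y f = zeroʳ y
  *-∑ (x ∷ xs) y f = trans (distribˡ y _ _) (+-congˡ (*-∑ xs y f))

  ∑-swap : ∀ {a b} {A : Set a} {B : Set b} (xs : List A) (ys : List B)
           (f : A → B → Carrier) →
           ∑ xs (λ x → ∑ ys (f x)) ≈ ∑ ys (λ y → ∑ xs (λ x → f x y))
  ∑-swap []       ys f = sym (∑-zero ys)
  ∑-swap (x ∷ xs) ys f =
    trans (+-congˡ (∑-swap xs ys f)) (sym (∑-+ ys _ _))

  ∑-++ : ∀ {a} {A : Set a} (xs ys : List A) (f : A → Carrier) →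
         ∑ (xs ++ ys) f ≈ ∑ xs f + ∑ ys f
  ∑-++ []       ys f = sym (+-identityˡ _)
  ∑-++ (x ∷ xs) ys f = trans (+-congˡ (∑-++ xs ys f)) (sym (+-assoc _ _ _))

  ∑-map : ∀ {a b} {A : Set a} {B : Set b} (h : A → B) (xs : List A)
          (f : B → Carrier) → ∑ (map h xs) f ≈ ∑ xs (λ x → f (h x))
  ∑-map h []       f = refl
  ∑-map h (x ∷ xs) f = +-congˡ (∑-map h xs f)

  ∑-concatMap : ∀ {a b} {A : Set a} {B : Set b} (h : A → List B) (xs : List A)
                (f : B → Carrier) →
                ∑ (concatMap h xs) f ≈ ∑ xs (λ x → ∑ (h x) f)
  ∑-concatMap h []       f = refl
  ∑-concatMap h (x ∷ xs) f =
    trans (∑-++ (h x) _ f) (+-congˡ (∑-concatMap h xs f))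

  -- `range` lists its entries in descending order, so the term at 0 comes last and splitting it off
  -- takes an induction.
  ∑-range-suc : ∀ b (f : ℕ → Carrier) →
                ∑ (range (suc b)) f ≈ f 0 + ∑ (range b) (λ j → f (suc j))
  ∑-range-suc zero    f =
    solve 2 (λ x y → x :+ (y :+ con 0) := y :+ (x :+ con 0)) refl (f 1) (f 0)
  ∑-range-suc (suc b) f = trans (+-congˡ (∑-range-suc b f))
    (solve 3 (λ x y z → x :+ (y :+ z) := y :+ (x :+ z)) refl (f (suc (suc b))) (f 0) _)

  ∑-range-head : ∀ b (f : ℕ → Carrier) → (∀ j → f (suc j) ≈ 0#) →
                 ∑ (range b) f ≈ f 0
  ∑-range-head zero    f f≈0 = +-identityʳ _
  ∑-range-head (suc b) f f≈0 =
    trans (+-congʳ (f≈0 b)) (trans (+-identityˡ _) (∑-range-head b f f≈0))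

  -- Comparison of coefficients for truncated series: since the terms at `suc b` vanish, both sums
  -- extend by one index for free, and after splitting off index 0 the term `h j` pairs with
  -- `f (suc j)`. Every functional equation in the parameter k below is an instance.
  ∑-range-shift : ∀ b (f g h : ℕ → Carrier) → f (suc b) ≈ 0# → g (suc b) ≈ 0# →
                  f 0 ≈ g 0 → (∀ j → f (suc j) + h j ≈ g (suc j)) →
                  ∑ (range b) f + ∑ (range b) h ≈ ∑ (range b) g
  ∑-range-shift b f g h f≈0 g≈0 f0≈g0 step = begin
    ∑ (range b) f + ∑ (range b) h
      ≈⟨ +-congʳ (split f f≈0) ⟩
    (f 0 + ∑ (range b) (λ j → f (suc j))) + ∑ (range b) h
      ≈⟨ +-assoc _ _ _ ⟩
    f 0 + (∑ (range b) (λ j → f (suc j)) + ∑ (range b) h)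
      ≈⟨ +-cong f0≈g0 (sym (∑-+ (range b) _ _)) ⟩
    g 0 + ∑ (range b) (λ j → f (suc j) + h j)
      ≈⟨ +-congˡ (∑-cong (range b) step) ⟩
    g 0 + ∑ (range b) (λ j → g (suc j))
      ≈⟨ split g g≈0 ⟨
    ∑ (range b) g ∎
    where
    split : ∀ e → e (suc b) ≈ 0# →
            ∑ (range b) e ≈ e 0 + ∑ (range b) (λ j → e (suc j))
    split e e≈0 = begin
      ∑ (range b) e             ≈⟨ +-identityˡ _ ⟨
      0# + ∑ (range b) e        ≈⟨ +-congʳ e≈0 ⟨
      ∑ (range (suc b)) e       ≈⟨ ∑-range-suc b e ⟩
      e 0 + ∑ (range b) (λ j → e (suc j)) ∎

-- I j and B N M stand for 1/(q;q)_j and the q-binomial coefficient.  Keeping the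
-- ring abstract prevents products from unfolding to convolutions.
record QStructure {c ℓ} (R : CommutativeRing c ℓ) (n : ℕ) : Set (c ⊔ ℓ) where
  open CommutativeRing R
  open Exp semiring using (_^_)
  field
    q          : Carrier
    q^1+n≈0    : q ^ suc n ≈ 0#
    poch       : ℕ → Carrier
    poch-zero  : poch 0 ≈ 1#
    poch-suc   : ∀ j → poch (suc j) ≈ poch j * (1# + - q ^ suc j)
    I          : ℕ → Carrier
    I-inverseˡ : ∀ j → I j * poch j ≈ 1#
    B          : ℕ → ℕ → Carrier
    B-≤        : ∀ {N M} → M ≤ N → B N M ≈ poch N * I M * I (N ∸ M)
    B->        : ∀ {N M} → N < M → B N M ≈ 0#

δ-same : ∀ a → δ a a ≡ 1
δ-same a rewrite dec-true (a ≟ a) ≡.refl = ≡.refl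

δ-distinct : ∀ {i a} → i ≢ a → δ i a ≡ 0
δ-distinct {i} {a} i≢a rewrite dec-false (i ≟ a) i≢a = ≡.refl

module Reversal {c ℓ} (R : CommutativeRing c ℓ) (n : ℕ) (Q : QStructure R n) where
  open CommutativeRing R hiding (zero)
  open QStructure Q
  open Exp semiring
  open ListSum R
  open GroupProperties +-group using (∙-cancelʳ)
  open RingProperties ring using (-1*x≈-x)
  open SemiringSolver commutativeSemiring using (solve; _:+_; _:*_; _:=_; con)
  open import Relation.Binary.Reasoning.Setoid setoid

  -- Recurrences for 1/(q;q)_j and the q-Pascal rule

  I-zero : I 0 ≈ 1#
  I-zero = trans (sym (*-identityʳ _)) (trans (*-congˡ (sym poch-zero)) (I-inverseˡ 0))

  -- Stated with the negative term moved across, because the semiring solver treats negation as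
  -- opaque; the later recurrences are subtraction-free for the same reason.
  poch-step : ∀ j → poch j ≈ poch (suc j) + q ^ suc j * poch j
  poch-step j = begin
    p                            ≈⟨ *-identityʳ p ⟨
    p * 1#                       ≈⟨ *-congˡ (trans (+-congˡ (-‿inverseˡ u)) (+-identityʳ 1#)) ⟨
    p * (1# + (- u + u))         ≈⟨ solve 4 (λ p o m u → p :* (o :+ (m :+ u)) := p :* (o :+ m) :+ u :* p)
                                      refl p 1# (- u) u ⟩
    p * (1# + - u) + u * p       ≈⟨ +-congʳ (poch-suc j) ⟨
    poch (suc j) + u * p         ∎
    where
    p = poch j
    u = q ^ suc j

  -- This is 1/(q;q)_j = (1 - q^(j+1))/(q;q)_(j+1). Both terms are brought to a common denominator
  -- by inserting `I j * poch j` and `I (suc j) * poch (suc j)`, each equal to 1.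
  I-suc : ∀ j → q ^ suc j * I (suc j) + I j ≈ I (suc j)
  I-suc j = begin
    u * y + x
      ≈⟨ +-cong (*-congˡ (sym (*-identityʳ y))) (sym (*-identityʳ x)) ⟩
    u * (y * 1#) + x * 1#
      ≈⟨ +-cong (*-congˡ (*-congˡ (I-inverseˡ j))) (*-congˡ (I-inverseˡ (suc j))) ⟨
    u * (y * (x * p)) + x * (y * p′)
      ≈⟨ solve 5 (λ u y x p p′ → u :* (y :* (x :* p)) :+ x :* (y :* p′) := y :* (x :* (p′ :+ u :* p)))
           refl u y x p p′ ⟩
    y * (x * (p′ + u * p))
      ≈⟨ *-congˡ (*-congˡ (poch-step j)) ⟨
    y * (x * p)
      ≈⟨ *-congˡ (I-inverseˡ j) ⟩
    y * 1#
      ≈⟨ *-identityʳ y ⟩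
    y ∎
    where
    u = q ^ suc j
    x = I j
    y = I (suc j)
    p = poch j
    p′ = poch (suc j)

  B-diagonal : ∀ N → B N N ≈ 1#
  B-diagonal N = begin
    B N N                           ≈⟨ B-≤ ℕ.≤-refl ⟩
    poch N * I N * I (N ℕ.∸ N)        ≡⟨ ≡.cong (λ d → poch N * I N * I d) (ℕ.n∸n≡0 N) ⟩
    poch N * I N * I 0                ≈⟨ *-cong (trans (*-comm _ _) (I-inverseˡ N)) I-zero ⟩
    1# * 1#                            ≈⟨ *-identityˡ 1# ⟩
    1#                                 ∎

  B-col-zero : ∀ N → B N 0 ≈ 1#
  B-col-zero N = begin
    B N 0                  ≈⟨ B-≤ z≤n ⟩
    poch N * I 0 * I N     ≈⟨ solve 3 (λ p a b → p :* a :* b := a :* (b :* p)) refl (poch N) (I 0) (I N) ⟩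
    I 0 * (I N * poch N)  ≈⟨ *-cong I-zero (I-inverseˡ N) ⟩
    1# * 1#                ≈⟨ *-identityˡ 1# ⟩
    1#                     ∎

  -- Writing the upper index as d + M removes the truncated subtraction from the formula for `B`.
  B-+ : ∀ M d → B (d ℕ.+ M) M ≈ poch (d ℕ.+ M) * I M * I d
  B-+ M d = trans (B-≤ (ℕ.m≤n+m M d))
    (reflexive (≡.cong (λ x → poch (d ℕ.+ M) * I M * I x) (ℕ.m+n∸n≡m d M)))

  -- Adding q^(N+1) (q;q)_N / ((q;q)_(M+1) (q;q)_(d+1)) turns both sides into (q;q)_N / ((q;q)_(M+1)
  -- (q;q)_(d+1)): on the left by `I-suc` at d and at M, on the right by `poch-step` at N. The added
  -- term is then cancelled.
  pascal-interior : ∀ M d → q ^ suc M * B (suc d ℕ.+ M) (suc M) + B (suc d ℕ.+ M) M ≈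
                            B (suc (suc d ℕ.+ M)) (suc M)
  pascal-interior M d = ∙-cancelʳ (u * v * p * x * y) _ _ (begin
    u * B N (suc M) + B N M + u * v * p * x * y
      ≈⟨ +-congʳ (+-cong (*-congˡ left) (B-+ M (suc d))) ⟩
    u * (p * x * I d) + p * I M * y + u * v * p * x * y
      ≈⟨ solve 7 (λ u v p x y a b → u :* (p :* x :* a) :+ p :* b :* y :+ u :* v :* p :* x :* y :=
           p :* (u :* x :* (v :* y :+ a) :+ b :* y)) refl u v p x y (I d) (I M) ⟩
    p * (u * x * (v * y + I d) + I M * y)
      ≈⟨ *-congˡ (+-congʳ (*-congˡ (I-suc d))) ⟩
    p * (u * x * y + I M * y)
      ≈⟨ *-congˡ (distribʳ y _ _) ⟨
    p * ((u * x + I M) * y)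
      ≈⟨ *-congˡ (*-congʳ (I-suc M)) ⟩
    p * (x * y)
      ≈⟨ *-congʳ (poch-step N) ⟩
    (poch (suc N) + q ^ suc N * p) * (x * y)
      ≈⟨ *-congʳ (+-congˡ (*-congʳ q^1+N≈uv)) ⟩
    (poch (suc N) + u * v * p) * (x * y)
      ≈⟨ solve 6 (λ p′ u v p x y → (p′ :+ u :* v :* p) :* (x :* y) := p′ :* x :* y :+ u :* v :* p :* x :* y)
           refl (poch (suc N)) u v p x y ⟩
    poch (suc N) * x * y + u * v * p * x * y
      ≈⟨ +-congʳ right ⟨
    B (suc N) (suc M) + u * v * p * x * y ∎)
    where
    N = suc d ℕ.+ M
    u = q ^ suc M
    v = q ^ suc d
    p = poch N
    x = I (suc M)
    y = I (suc d)
    left : B N (suc M) ≈ p * x * I d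
    left = ≡.subst (λ N → B N (suc M) ≈ poch N * x * I d) (ℕ.+-suc d M) (B-+ (suc M) d)
    right : B (suc N) (suc M) ≈ poch (suc N) * x * y
    right = ≡.subst (λ N → B N (suc M) ≈ poch N * x * y) (ℕ.+-suc (suc d) M) (B-+ (suc M) (suc d))
    q^1+N≈uv : q ^ suc N ≈ u * v
    q^1+N≈uv = begin
      q ^ suc N              ≡⟨ ≡.cong (q ^_) (≡.trans (≡.sym (ℕ.+-suc (suc d) M)) (ℕ.+-comm (suc d) (suc M))) ⟩
      q ^ (suc M ℕ.+ suc d)  ≈⟨ ^-homo-* q (suc M) (suc d) ⟩
      u * v                  ∎

  pascal : ∀ N M → q ^ suc M * B N (suc M) + B N M ≈ B (suc N) (suc M)
  pascal N M with ℕ.<-cmp N M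
  ... | tri< N<M _ _ = begin
    q ^ suc M * B N (suc M) + B N M
      ≈⟨ +-cong (*-congˡ (B-> (ℕ.m<n⇒m<1+n N<M))) (B-> N<M) ⟩
    q ^ suc M * 0# + 0#    ≈⟨ trans (+-identityʳ _) (zeroʳ _) ⟩
    0#                     ≈⟨ B-> (s≤s N<M) ⟨
    B (suc N) (suc M)   ∎
  ... | tri≈ _ ≡.refl _ = begin
    q ^ suc N * B N (suc N) + B N N
      ≈⟨ +-congʳ (*-congˡ (B-> (ℕ.n<1+n N))) ⟩
    q ^ suc N * 0# + B N N   ≈⟨ trans (+-congʳ (zeroʳ _)) (+-identityˡ _) ⟩
    B N N                    ≈⟨ trans (B-diagonal N) (sym (B-diagonal (suc N))) ⟩
    B (suc N) (suc N)        ∎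
  ... | tri> _ _ M<N = ≡.subst
    (λ N → q ^ suc M * B N (suc M) + B N M ≈ B (suc N) (suc M))
    (≡.trans (≡.sym (ℕ.+-suc (N ℕ.∸ suc M) M)) (ℕ.m∸n+n≡m M<N))
    (pascal-interior M (N ℕ.∸ suc M))

  -- Truncated Euler expansions and the q-binomial theorem

  ^-split : ∀ {e} a b → e ≡ a ℕ.+ b → q ^ e ≈ q ^ a * q ^ b
  ^-split a b ≡.refl = ^-homo-* q a b

  ^-vanish : ∀ e → suc n ≤ e → q ^ e ≈ 0#
  ^-vanish e n<e = begin
    q ^ e                          ≈⟨ ^-split (suc n) (e ℕ.∸ suc n) (≡.sym (ℕ.m+[n∸m]≡n n<e)) ⟩
    q ^ suc n * q ^ (e ℕ.∸ suc n)  ≈⟨ *-congʳ q^1+n≈0 ⟩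
    0# * q ^ (e ℕ.∸ suc n)         ≈⟨ zeroˡ _ ⟩
    0#                             ∎

  ^-vanish-* : ∀ e x → suc n ≤ e → q ^ e * x ≈ 0#
  ^-vanish-* e x n<e = trans (*-congʳ (^-vanish e n<e)) (zeroˡ x)

  -- The coefficient of z^j in 1/(-z;q)_∞.
  σ : ℕ → Carrier
  σ j = (- 1#) ^ j * I j

  σ-suc : ∀ j → σ (suc j) + σ j ≈ q ^ suc j * σ (suc j)
  σ-suc j = begin
    - 1# * s * I (suc j) + s * I j
      ≈⟨ +-congʳ (*-congˡ (I-suc j)) ⟨
    - 1# * s * (q ^ suc j * I (suc j) + I j) + s * I j
      ≈⟨ solve 5 (λ m s u x y → m :* s :* (u :* x :+ y) :+ s :* y :=
           u :* (m :* s :* x) :+ (m :* (s :* y) :+ s :* y)) refl (- 1#) s (q ^ suc j) (I (suc j)) (I j) ⟩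
    q ^ suc j * (- 1# * s * I (suc j)) + (- 1# * (s * I j) + s * I j)
      ≈⟨ +-congˡ (trans (+-congʳ (-1*x≈-x _)) (-‿inverseˡ _)) ⟩
    q ^ suc j * (- 1# * s * I (suc j)) + 0#
      ≈⟨ +-identityʳ _ ⟩
    q ^ suc j * (- 1# * s * I (suc j)) ∎
    where s = (- 1#) ^ j

  σ-zero : σ 0 ≈ 1#
  σ-zero = trans (*-identityˡ _) I-zero

  -- E k is 1/(-q^(k+1);q)_∞ by Euler's expansion.
  e : ℕ → ℕ → Carrier
  e k j = q ^ (j ℕ.+ k ℕ.* j) * σ j

  E : ℕ → Carrier
  E k = ∑ (range n) (e k)

  -- The functional equation of 1/(-zq;q)_∞ under z → zq, at z = q^k. Coefficientwise it is `σ-suc`;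
  -- the terms at index n + 1 carry a power of q that vanishes.
  E-suc : ∀ k → E k + q ^ suc k * E k ≈ E (suc k)
  E-suc k = trans (+-congˡ (*-∑ (range n) _ _))
    (∑-range-shift n (e k) (e (suc k)) (λ j → q ^ suc k * e k j)
      (^-vanish-* _ _ (ℕ.m≤m+n (suc n) _)) (^-vanish-* _ _ (ℕ.m≤m+n (suc n) _))
      (*-congʳ (^-congʳ q (lemma₀ k))) step)
    where
    lemma₀ : ∀ k → k ℕ.* 0 ≡ 0 ℕ.+ suc k ℕ.* 0
    lemma₀ = solve-∀
    lemma₁ : ∀ j k → suc j ℕ.+ k ℕ.* suc j ≡ suc k ℕ.+ (j ℕ.+ k ℕ.* j)
    lemma₁ = solve-∀
    lemma₂ : ∀ j k → suc j ℕ.+ suc k ℕ.* suc j ≡ (suc j ℕ.+ k ℕ.* suc j) ℕ.+ suc j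
    lemma₂ = solve-∀
    step : ∀ j → e k (suc j) + q ^ suc k * e k j ≈ e (suc k) (suc j)
    step j = begin
      x * σ (suc j) + q ^ suc k * (q ^ (j ℕ.+ k ℕ.* j) * σ j)
        ≈⟨ +-congˡ (trans (sym (*-assoc _ _ _))
             (*-congʳ (sym (^-split (suc k) _ (lemma₁ j k))))) ⟩
      x * σ (suc j) + x * σ j          ≈⟨ distribˡ x _ _ ⟨
      x * (σ (suc j) + σ j)            ≈⟨ *-congˡ (σ-suc j) ⟩
      x * (q ^ suc j * σ (suc j))      ≈⟨ *-assoc _ _ _ ⟨
      x * q ^ suc j * σ (suc j)        ≈⟨ *-congʳ (^-split (suc j ℕ.+ k ℕ.* suc j) (suc j) (lemma₂ j k)) ⟨
      e (suc k) (suc j) ∎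
      where x = q ^ (suc j ℕ.+ k ℕ.* suc j)

  -- The series Σ_j q^(j(j+1)/2) c_j z^j at z = q^k. It covers Euler's expansion, with c = `I`, and
  -- the q-binomial sum, with c = `B N`.
  W : (ℕ → Carrier) → ℕ → Carrier
  W c k = ∑ (range n) (λ j → q ^ (tri j ℕ.+ k ℕ.* j) * c j)

  -- A Pascal-type recurrence between coefficients becomes multiplication by 1 + q^(k+1), because
  -- tri (j+1) = (j+1) + tri j. With `I-suc` it yields `P-suc`; with `pascal` it yields the
  -- induction step of `W-B`.
  W-suc : ∀ (c d : ℕ → Carrier) k → c 0 ≈ d 0 →
          (∀ j → q ^ suc j * c (suc j) + c j ≈ d (suc j)) →
          W c (suc k) + q ^ suc k * W c (suc k) ≈ W d k
  W-suc c d k c0≈d0 c-suc = trans (+-congˡ (*-∑ (range n) _ _))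
    (∑-range-shift n _ _ _
      (^-vanish-* _ _ bound) (^-vanish-* _ _ bound)
      (*-cong (^-congʳ q (lemma₀ k)) c0≈d0) step)
    where
    bound : ∀ {x} → suc n ≤ (suc n ℕ.+ tri n) ℕ.+ x
    bound = ℕ.≤-trans (ℕ.m≤m+n (suc n) _) (ℕ.m≤m+n _ _)
    lemma₀ : ∀ k → suc k ℕ.* 0 ≡ k ℕ.* 0
    lemma₀ = solve-∀
    lemma₁ : ∀ j k t → (suc j ℕ.+ t) ℕ.+ k ℕ.* suc j ≡ suc k ℕ.+ (t ℕ.+ suc k ℕ.* j)
    lemma₁ = solve-∀
    lemma₂ : ∀ j k t → (suc j ℕ.+ t) ℕ.+ suc k ℕ.* suc j ≡ ((suc j ℕ.+ t) ℕ.+ k ℕ.* suc j) ℕ.+ suc j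
    lemma₂ = solve-∀
    step : ∀ j → q ^ (tri (suc j) ℕ.+ suc k ℕ.* suc j) * c (suc j) +
                 q ^ suc k * (q ^ (tri j ℕ.+ suc k ℕ.* j) * c j) ≈
                 q ^ (tri (suc j) ℕ.+ k ℕ.* suc j) * d (suc j)
    step j = begin
      q ^ (tri (suc j) ℕ.+ suc k ℕ.* suc j) * c (suc j) +
        q ^ suc k * (q ^ (tri j ℕ.+ suc k ℕ.* j) * c j)
        ≈⟨ +-cong (trans (*-congʳ (^-split (tri (suc j) ℕ.+ k ℕ.* suc j) (suc j) (lemma₂ j k (tri j)))) (*-assoc _ _ _))
                  (trans (sym (*-assoc _ _ _)) (*-congʳ (sym (^-split (suc k) _ (lemma₁ j k (tri j)))))) ⟩
      x * (q ^ suc j * c (suc j)) + x * c j   ≈⟨ distribˡ x _ _ ⟨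
      x * (q ^ suc j * c (suc j) + c j)       ≈⟨ *-congˡ (c-suc j) ⟩
      x * d (suc j) ∎
      where x = q ^ (tri (suc j) ℕ.+ k ℕ.* suc j)

  -- P k is (-q^(k+1);q)_∞.
  P : ℕ → Carrier
  P = W I

  P-suc : ∀ k → P (suc k) + q ^ suc k * P (suc k) ≈ P k
  P-suc k = W-suc I I k refl I-suc

  P*E-suc : ∀ k → P k * E k ≈ P (suc k) * E (suc k)
  P*E-suc k = begin
    P k * E k                                    ≈⟨ *-congʳ (P-suc k) ⟨
    (P (suc k) + q ^ suc k * P (suc k)) * E k
      ≈⟨ solve 3 (λ p u x → (p :+ u :* p) :* x := p :* (x :+ u :* x)) refl (P (suc k)) (q ^ suc k) (E k) ⟩
    P (suc k) * (E k + q ^ suc k * E k)          ≈⟨ *-congˡ (E-suc k) ⟩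
    P (suc k) * E (suc k)                        ∎

  P*E-large : ∀ k → suc n ≤ k → P k * E k ≈ 1#
  P*E-large k n<k = begin
    P k * E k
      ≈⟨ *-cong (∑-range-head n _ (λ j → ^-vanish-* _ _ (bound (tri (suc j)) j)))
                (∑-range-head n _ (λ j → ^-vanish-* _ _ (bound (suc j) j))) ⟩
    q ^ (k ℕ.* 0) * I 0 * (q ^ (k ℕ.* 0) * σ 0)
      ≈⟨ *-cong (*-cong (^-congʳ q (ℕ.*-zeroʳ k)) I-zero)
                (*-cong (^-congʳ q (ℕ.*-zeroʳ k)) σ-zero) ⟩
    1# * 1# * (1# * 1#)
      ≈⟨ solve 0 (con 1 :* con 1 :* (con 1 :* con 1) := con 1) refl ⟩
    1# ∎
    where
    bound : ∀ x j → suc n ≤ x ℕ.+ k ℕ.* suc j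
    bound x j = ℕ.≤-trans n<k (ℕ.≤-trans (ℕ.m≤m*n k (suc j)) (ℕ.m≤n+m _ x))

  -- P k * E k does not depend on k, and for k > n only the constant terms survive.
  P*E≈1 : ∀ k → P k * E k ≈ 1#
  P*E≈1 k = go (suc n) k (ℕ.m≤m+n (suc n) k)
    where
    -- The argument k is raised until it exceeds n; d bounds the number of steps left.
    go : ∀ d k → suc n ≤ d ℕ.+ k → P k * E k ≈ 1#
    go zero    k n<k = P*E-large k n<k
    go (suc d) k n<k = trans (P*E-suc k)
      (go d (suc k) (≡.subst (suc n ≤_) (≡.sym (ℕ.+-suc d k)) n<k))

  -- The q-binomial theorem: both sides are (1 + q^(k+1)) ⋯ (1 + q^(k+N)).
  W-B : ∀ N k → W (B N) k ≈ P k * E (k ℕ.+ N)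
  W-B zero k = begin
    W (B 0) k
      ≈⟨ ∑-range-head n _ (λ j → trans (*-congˡ (B-> (s≤s z≤n))) (zeroʳ _)) ⟩
    q ^ (k ℕ.* 0) * B 0 0    ≈⟨ *-cong (^-congʳ q (ℕ.*-zeroʳ k)) (B-col-zero 0) ⟩
    1# * 1#                  ≈⟨ *-identityˡ 1# ⟩
    1#                       ≈⟨ P*E≈1 k ⟨
    P k * E k                ≡⟨ ≡.cong (λ m → P k * E m) (ℕ.+-identityʳ k) ⟨
    P k * E (k ℕ.+ 0)        ∎
  W-B (suc N) k = begin
    W (B (suc N)) k
      ≈⟨ W-suc (B N) (B (suc N)) k (trans (B-col-zero N) (sym (B-col-zero (suc N)))) (pascal N) ⟨
    W (B N) (suc k) + q ^ suc k * W (B N) (suc k)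
      ≈⟨ +-cong (W-B N (suc k)) (*-congˡ (W-B N (suc k))) ⟩
    P (suc k) * x + q ^ suc k * (P (suc k) * x)
      ≈⟨ solve 3 (λ p u x → p :* x :+ u :* (p :* x) := (p :+ u :* p) :* x) refl (P (suc k)) (q ^ suc k) x ⟩
    (P (suc k) + q ^ suc k * P (suc k)) * x
      ≈⟨ *-congʳ (P-suc k) ⟩
    P k * x
      ≡⟨ ≡.cong (λ m → P k * E m) (ℕ.+-suc k N) ⟨
    P k * E (k ℕ.+ suc N) ∎
    where x = E (suc k ℕ.+ N)

  -- The operators in coordinates with respect to powers of q^N

  T : (ℕ → Carrier) → ℕ → Carrier
  T f N = ∑ (range n) (λ M → q ^ tri M * B N M * f M)

  U : (ℕ → Carrier) → Carrier
  U f = ∑ (range n) (λ N → q ^ tri N * I N * f N)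

  T-cong : ∀ {f g} → (∀ N → f N ≈ g N) → ∀ N → T f N ≈ T g N
  T-cong f≈g N = ∑-cong (range n) (λ M → *-congˡ (f≈g M))

  U-cong : ∀ {f g} → (∀ N → f N ≈ g N) → U f ≈ U g
  U-cong f≈g = ∑-cong (range n) (λ M → *-congˡ (f≈g M))

  -- The function of N with coefficient x k at (q^N)^k, up to the row factor of T.
  hat : (ℕ → Carrier) → ℕ → Carrier
  hat x N = ∑ (range n) (λ k → e N k * x k)

  -- The factor q^k σ_k that `hat` attaches to coordinate k, times the column factor (-q^(k+1);q)_∞
  -- of T. It serves also as the weight of the bilinear form.
  w : ℕ → Carrier
  w k = q ^ k * σ k * P k

  -- The matrix of T in `hat` coordinates: the symmetric matrix (q^(jk)) times the diagonal matrix
  -- of `w`.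
  K : (ℕ → Carrier) → ℕ → Carrier
  K x j = ∑ (range n) (λ k → q ^ (j ℕ.* k) * (w k * x k))

  ⟨_,_⟩ : (ℕ → Carrier) → (ℕ → Carrier) → Carrier
  ⟨ x , y ⟩ = ∑ (range n) (λ k → w k * (x k * y k))

  -- Interchanging the sums leaves, for each k, the inner sum over M in the form `W c k`. Taking c =
  -- `B N` treats T, and c = `I` treats U.
  ∑-weighted-hat : ∀ (c x : ℕ → Carrier) →
    ∑ (range n) (λ M → q ^ tri M * c M * hat x M) ≈
    ∑ (range n) (λ k → q ^ k * σ k * x k * W c k)
  ∑-weighted-hat c x = begin
    ∑ (range n) (λ M → q ^ tri M * c M * hat x M)
      ≈⟨ ∑-cong (range n) (λ M → *-∑ (range n) _ _) ⟩
    ∑ (range n) (λ M → ∑ (range n) (λ k → q ^ tri M * c M * (e M k * x k)))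
      ≈⟨ ∑-swap (range n) (range n) _ ⟩
    ∑ (range n) (λ k → ∑ (range n) (λ M → q ^ tri M * c M * (e M k * x k)))
      ≈⟨ ∑-cong (range n) (λ k → ∑-cong (range n) (λ M → termwise k M)) ⟩
    ∑ (range n) (λ k → ∑ (range n) (λ M →
      q ^ k * σ k * x k * (q ^ (tri M ℕ.+ k ℕ.* M) * c M)))
      ≈⟨ ∑-cong (range n) (λ k → *-∑ (range n) _ _) ⟨
    ∑ (range n) (λ k → q ^ k * σ k * x k * W c k) ∎
    where
    termwise : ∀ k M → q ^ tri M * c M * (e M k * x k) ≈
                       q ^ k * σ k * x k * (q ^ (tri M ℕ.+ k ℕ.* M) * c M)
    termwise k M = begin
      q ^ tri M * c M * (q ^ (k ℕ.+ M ℕ.* k) * σ k * x k)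
        ≈⟨ *-congˡ (*-congʳ (*-congʳ (^-split k (k ℕ.* M) (≡.cong (k ℕ.+_) (ℕ.*-comm M k))))) ⟩
      q ^ tri M * c M * (q ^ k * q ^ (k ℕ.* M) * σ k * x k)
        ≈⟨ solve 6 (λ t c u v s x → t :* c :* (u :* v :* s :* x) := u :* s :* x :* (t :* v :* c)) refl
             (q ^ tri M) (c M) (q ^ k) (q ^ (k ℕ.* M)) (σ k) (x k) ⟩
      q ^ k * σ k * x k * (q ^ tri M * q ^ (k ℕ.* M) * c M)
        ≈⟨ *-congˡ (*-congʳ (^-homo-* q (tri M) (k ℕ.* M))) ⟨
      q ^ k * σ k * x k * (q ^ (tri M ℕ.+ k ℕ.* M) * c M) ∎

  -- By `W-B` the inner sum is `P k * E (k + N)`. Expanding `E (k + N)` over j splits q^((k+N)j)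
  -- into q^(Nj), which belongs to `hat`, and the kernel q^(jk) of `K`.
  T-hat : ∀ x N → T (hat x) N ≈ hat (K x) N
  T-hat x N = begin
    T (hat x) N
      ≈⟨ ∑-weighted-hat (B N) x ⟩
    ∑ (range n) (λ k → q ^ k * σ k * x k * W (B N) k)
      ≈⟨ ∑-cong (range n) (λ k → trans (*-congˡ (W-B N k))
           (trans (sym (*-assoc _ _ _)) (*-∑ (range n) _ _))) ⟩
    ∑ (range n) (λ k → ∑ (range n) (λ j → q ^ k * σ k * x k * P k * e (k ℕ.+ N) j))
      ≈⟨ ∑-swap (range n) (range n) _ ⟩
    ∑ (range n) (λ j → ∑ (range n) (λ k → q ^ k * σ k * x k * P k * e (k ℕ.+ N) j))
      ≈⟨ ∑-cong (range n) (λ j → ∑-cong (range n) (λ k → termwise j k)) ⟩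
    ∑ (range n) (λ j → ∑ (range n) (λ k → e N j * (q ^ (j ℕ.* k) * (w k * x k))))
      ≈⟨ ∑-cong (range n) (λ j → *-∑ (range n) _ _) ⟨
    hat (K x) N ∎
    where
    lemma : ∀ j k N → j ℕ.+ (k ℕ.+ N) ℕ.* j ≡ (j ℕ.+ N ℕ.* j) ℕ.+ j ℕ.* k
    lemma = solve-∀
    termwise : ∀ j k → q ^ k * σ k * x k * P k * e (k ℕ.+ N) j ≈
                       e N j * (q ^ (j ℕ.* k) * (w k * x k))
    termwise j k = begin
      q ^ k * σ k * x k * P k * (q ^ (j ℕ.+ (k ℕ.+ N) ℕ.* j) * σ j)
        ≈⟨ *-congˡ (*-congʳ (^-split _ (j ℕ.* k) (lemma j k N))) ⟩
      q ^ k * σ k * x k * P k * (q ^ (j ℕ.+ N ℕ.* j) * q ^ (j ℕ.* k) * σ j)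
        ≈⟨ solve 7 (λ u s x p a b t → u :* s :* x :* p :* (a :* b :* t) :=
             a :* t :* (b :* (u :* s :* p :* x))) refl
             (q ^ k) (σ k) (x k) (P k) (q ^ (j ℕ.+ N ℕ.* j)) (q ^ (j ℕ.* k)) (σ j) ⟩
      e N j * (q ^ (j ℕ.* k) * (w k * x k)) ∎

  𝟙 : ℕ → Carrier
  𝟙 _ = 1#

  -- Here the inner sum is `W I k`, which is `P k`, so only the weight `w k` remains.
  U-hat : ∀ x → U (hat x) ≈ ⟨ 𝟙 , x ⟩
  U-hat x = trans (∑-weighted-hat I x) (∑-cong (range n) (λ k →
    solve 4 (λ u s x p → u :* s :* x :* p := u :* s :* p :* (con 1 :* x)) refl
      (q ^ k) (σ k) (x k) (P k)))

  -- The function 𝟙 is the zeroth power of q^N, and column 0 of (q^(jk)) is constant. Hence T 𝟙 has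
  -- coordinates proportional to 𝟙, the very vector that U pairs with; this matches the two ends of
  -- the operator product.
  T-𝟙 : ∀ N → T 𝟙 N ≈ hat (λ _ → P 0) N
  T-𝟙 N = begin
    T 𝟙 N      ≈⟨ ∑-cong (range n) (λ M → trans (*-identityʳ _)
                    (*-congʳ (^-congʳ q (≡.sym (ℕ.+-identityʳ (tri M)))))) ⟩
    W (B N) 0  ≈⟨ W-B N 0 ⟩
    P 0 * E N  ≈⟨ *-∑ (range n) _ _ ⟩
    ∑ (range n) (λ k → P 0 * e N k)  ≈⟨ ∑-cong (range n) (λ k → *-comm _ _) ⟩
    hat (λ _ → P 0) N ∎

  D : (ℕ → Carrier) → ℕ → Carrier
  D x k = q ^ k * x k

  -- Replacing N by N + 1 multiplies (q^N)^k by q^k, so the shift is diagonal.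
  hat-D : ∀ x N → hat x (suc N) ≈ hat (D x) N
  hat-D x N = ∑-cong (range n) λ k → begin
    q ^ (k ℕ.+ suc N ℕ.* k) * σ k * x k
      ≈⟨ *-congʳ (*-congʳ (^-split _ k (lemma k N))) ⟩
    q ^ (k ℕ.+ N ℕ.* k) * q ^ k * σ k * x k
      ≈⟨ solve 4 (λ a b s x → a :* b :* s :* x := a :* s :* (b :* x)) refl _ _ _ _ ⟩
    e N k * D x k ∎
    where
    lemma : ∀ k N → k ℕ.+ suc N ℕ.* k ≡ (k ℕ.+ N ℕ.* k) ℕ.+ k
    lemma = solve-∀

  K-cong : ∀ {x y} → (∀ k → x k ≈ y k) → ∀ j → K x j ≈ K y j
  K-cong x≈y j = ∑-cong (range n) (λ k → *-congˡ (*-congˡ (x≈y k)))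

  K^-scale : ∀ c b j → fold (λ _ → c) K b j ≈ c * fold 𝟙 K b j
  K^-scale c zero    j = sym (*-identityʳ c)
  K^-scale c (suc b) j = begin
    K (fold (λ _ → c) K b) j
      ≈⟨ K-cong (K^-scale c b) j ⟩
    K (λ k → c * fold 𝟙 K b k) j
      ≈⟨ ∑-cong (range n) (λ k → solve 4 (λ u v c x → u :* (v :* (c :* x)) := c :* (u :* (v :* x))) refl
           (q ^ (j ℕ.* k)) (w k) c (fold 𝟙 K b k)) ⟩
    ∑ (range n) (λ k → c * (q ^ (j ℕ.* k) * (w k * fold 𝟙 K b k)))
      ≈⟨ *-∑ (range n) _ _ ⟨
    c * fold 𝟙 K (suc b) j ∎

  -- Self-adjointness and the exchange of the two ends

  ⟨⟩-cong : ∀ {x x′ y y′} → (∀ k → x k ≈ x′ k) → (∀ k → y k ≈ y′ k) → ⟨ x , y ⟩ ≈ ⟨ x′ , y′ ⟩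
  ⟨⟩-cong x≈x′ y≈y′ = ∑-cong (range n) (λ k → *-congˡ (*-cong (x≈x′ k) (y≈y′ k)))

  ⟨⟩-comm : ∀ x y → ⟨ x , y ⟩ ≈ ⟨ y , x ⟩
  ⟨⟩-comm x y = ∑-cong (range n) (λ k → *-congˡ (*-comm _ _))

  D-adjoint : ∀ x y → ⟨ x , D y ⟩ ≈ ⟨ D x , y ⟩
  D-adjoint x y = ∑-cong (range n) (λ k →
    *-congˡ (solve 3 (λ u x y → x :* (u :* y) := u :* x :* y) refl (q ^ k) (x k) (y k)))

  -- The kernel w_j q^(jk) w_k is symmetric in j and k.
  K-adjoint : ∀ x y → ⟨ x , K y ⟩ ≈ ⟨ K x , y ⟩
  K-adjoint x y = begin
    ⟨ x , K y ⟩
      ≈⟨ ∑-cong (range n) (λ j → trans (sym (*-assoc _ _ _)) (*-∑ (range n) _ _)) ⟩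
    ∑ (range n) (λ j → ∑ (range n) (λ k → w j * x j * (q ^ (j ℕ.* k) * (w k * y k))))
      ≈⟨ ∑-swap (range n) (range n) _ ⟩
    ∑ (range n) (λ k → ∑ (range n) (λ j → w j * x j * (q ^ (j ℕ.* k) * (w k * y k))))
      ≈⟨ ∑-cong (range n) (λ k → ∑-cong (range n) (λ j → termwise j k)) ⟩
    ∑ (range n) (λ k → ∑ (range n) (λ j → w k * y k * (q ^ (k ℕ.* j) * (w j * x j))))
      ≈⟨ ∑-cong (range n) (λ k → trans (sym (*-assoc _ _ _)) (*-∑ (range n) _ _)) ⟨
    ⟨ y , K x ⟩
      ≈⟨ ⟨⟩-comm y (K x) ⟩
    ⟨ K x , y ⟩ ∎
    where
    termwise : ∀ j k → w j * x j * (q ^ (j ℕ.* k) * (w k * y k)) ≈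
                       w k * y k * (q ^ (k ℕ.* j) * (w j * x j))
    termwise j k = begin
      w j * x j * (q ^ (j ℕ.* k) * (w k * y k))
        ≈⟨ *-congˡ (*-congʳ (^-congʳ q (ℕ.*-comm j k))) ⟩
      w j * x j * (q ^ (k ℕ.* j) * (w k * y k))
        ≈⟨ solve 3 (λ a u b → a :* (u :* b) := b :* (u :* a)) refl _ _ _ ⟩
      w k * y k * (q ^ (k ℕ.* j) * (w j * x j)) ∎

  K^-adjoint : ∀ a x y → ⟨ x , fold y K a ⟩ ≈ ⟨ fold x K a , y ⟩
  K^-adjoint zero    x y = refl
  K^-adjoint (suc a) x y = begin
    ⟨ x , K (fold y K a) ⟩   ≈⟨ K-adjoint x _ ⟩
    ⟨ K x , fold y K a ⟩     ≈⟨ K^-adjoint a (K x) y ⟩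
    ⟨ fold (K x) K a , y ⟩   ≈⟨ ⟨⟩-cong (fold-K a) (λ _ → refl) ⟩
    ⟨ K (fold x K a) , y ⟩   ∎
    where
    fold-K : ∀ a j → fold (K x) K a j ≈ K (fold x K a) j
    fold-K zero    j = refl
    fold-K (suc a) j = K-cong (fold-K a) j

  T^-hat : ∀ a {f x} → (∀ N → f N ≈ hat x N) → ∀ N → fold f T a N ≈ hat (fold x K a) N
  T^-hat zero    f≈x̂ = f≈x̂
  T^-hat (suc a) f≈x̂ N = trans (T-cong (T^-hat a f≈x̂) N) (T-hat _ N)

  -- The innermost T is spent on turning 𝟙 into a constant coordinate vector, so b + 1 copies of T
  -- leave b copies of `K`.
  T^-𝟙 : ∀ b N → fold 𝟙 T (suc b) N ≈ hat (fold (λ _ → P 0) K b) N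
  T^-𝟙 zero    N = T-𝟙 N
  T^-𝟙 (suc b) N = trans (T-cong (T^-𝟙 b) N) (T-hat _ N)

  -- The sum for m = a + b + 2 with the shifted factor at place a + 1.
  J : ℕ → ℕ → Carrier
  J a b = U (fold (λ N → fold 𝟙 T (suc b) (suc N)) T a)

  -- In coordinates U is the pairing with 𝟙, and the a outer copies of `K` move to that side by
  -- adjointness. What remains is symmetric in a and b, since `D` is self-adjoint.
  J≈⟨⟩ : ∀ a b → J a b ≈ P 0 * ⟨ fold 𝟙 K a , D (fold 𝟙 K b) ⟩
  J≈⟨⟩ a b = begin
    J a b
      ≈⟨ U-cong (T^-hat a (λ N → trans (T^-𝟙 b (suc N)) (hat-D _ N))) ⟩
    U (hat (fold (D (fold (λ _ → P 0) K b)) K a))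
      ≈⟨ U-hat _ ⟩
    ⟨ 𝟙 , fold (D (fold (λ _ → P 0) K b)) K a ⟩
      ≈⟨ K^-adjoint a 𝟙 _ ⟩
    ⟨ fold 𝟙 K a , D (fold (λ _ → P 0) K b) ⟩
      ≈⟨ ⟨⟩-cong (λ _ → refl) (λ k → *-congˡ (K^-scale (P 0) b k)) ⟩
    ⟨ fold 𝟙 K a , D (λ k → P 0 * fold 𝟙 K b k) ⟩
      ≈⟨ ∑-cong (range n) (λ k → solve 5 (λ w x u p y →
           w :* (x :* (u :* (p :* y))) := p :* (w :* (x :* (u :* y)))) refl
           (w k) (fold 𝟙 K a k) (q ^ k) (P 0) (fold 𝟙 K b k)) ⟩
    ∑ (range n) (λ k → P 0 * (w k * (fold 𝟙 K a k * D (fold 𝟙 K b) k)))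
      ≈⟨ *-∑ (range n) _ _ ⟨
    P 0 * ⟨ fold 𝟙 K a , D (fold 𝟙 K b) ⟩ ∎

  J-sym : ∀ a b → J a b ≈ J b a
  J-sym a b = begin
    J a b                                    ≈⟨ J≈⟨⟩ a b ⟩
    P 0 * ⟨ fold 𝟙 K a , D (fold 𝟙 K b) ⟩    ≈⟨ *-congˡ (trans (D-adjoint _ _) (⟨⟩-comm _ _)) ⟩
    P 0 * ⟨ fold 𝟙 K b , D (fold 𝟙 K a) ⟩    ≈⟨ J≈⟨⟩ b a ⟨
    J b a                                    ∎

  -- The multiple sum as an iterated operator

  chainᴿ : ∀ {k} → ℕ → ℕ → Vec ℕ k → Carrier
  chainᴿ a i (x ∷ y ∷ rest) = B (x ℕ.+ δ i a) y * chainᴿ a (suc i) (y ∷ rest)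
  chainᴿ a i _              = 1#

  termᴿ : ∀ {k} → ℕ → Vec ℕ (suc k) → Carrier
  termᴿ a N@(x ∷ _) = q ^ sumTri N * I x * chainᴿ a 1 N

  -- G a k i N sums over the k variables that follow N_i = N.
  G : ℕ → ℕ → ℕ → ℕ → Carrier
  G a zero    i N = 1#
  G a (suc k) i N = ∑ (range n) (λ M → q ^ tri M * B (N ℕ.+ δ i a) M * G a k (suc i) M)

  ∑-tuples : ∀ k (f : Vec ℕ (suc k) → Carrier) →
    ∑ (tuples (suc k) n) f ≈ ∑ (range n) (λ x → ∑ (tuples k n) (λ xs → f (x ∷ xs)))
  ∑-tuples k f = trans (∑-concatMap _ (range n) f)
    (∑-cong (range n) (λ x → ∑-map (x ∷_) (tuples k n) f))

  ∑-chain : ∀ a k i N →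
    ∑ (tuples k n) (λ Ms → q ^ (sumTri Ms) * chainᴿ a i (N ∷ Ms)) ≈ G a k i N
  ∑-chain a zero    i N = trans (+-identityʳ _) (*-identityˡ 1#)
  ∑-chain a (suc k) i N = begin
    ∑ (tuples (suc k) n) (λ Ms → q ^ (sumTri Ms) * chainᴿ a i (N ∷ Ms))
      ≈⟨ ∑-tuples k _ ⟩
    ∑ (range n) (λ M → ∑ (tuples k n) (λ Ms →
      q ^ (tri M ℕ.+ sumTri Ms) * (B (N ℕ.+ δ i a) M * chainᴿ a (suc i) (M ∷ Ms))))
      ≈⟨ ∑-cong (range n) (λ M → ∑-cong (tuples k n) (λ Ms → trans (*-congʳ (^-homo-* q (tri M) (sumTri Ms)))
           (solve 4 (λ a b c d → a :* b :* (c :* d) := a :* c :* (b :* d)) refl _ _ _ _))) ⟩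
    ∑ (range n) (λ M → ∑ (tuples k n) (λ Ms →
      q ^ tri M * B (N ℕ.+ δ i a) M * (q ^ (sumTri Ms) * chainᴿ a (suc i) (M ∷ Ms))))
      ≈⟨ ∑-cong (range n) (λ M → trans (sym (*-∑ (tuples k n) _ _)) (*-congˡ (∑-chain a k (suc i) M))) ⟩
    G a (suc k) i N ∎

  ∑-term : ∀ a k → ∑ (tuples (suc k) n) (termᴿ a) ≈ U (G a k 1)
  ∑-term a k = begin
    ∑ (tuples (suc k) n) (termᴿ a)
      ≈⟨ ∑-tuples k _ ⟩
    ∑ (range n) (λ N → ∑ (tuples k n) (λ Ms →
      q ^ (tri N ℕ.+ sumTri Ms) * I N * chainᴿ a 1 (N ∷ Ms)))
      ≈⟨ ∑-cong (range n) (λ N → ∑-cong (tuples k n) (λ Ms → trans (*-congʳ (*-congʳ (^-homo-* q (tri N) (sumTri Ms))))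
           (solve 4 (λ a b c d → a :* b :* c :* d := a :* c :* (b :* d)) refl _ _ _ _))) ⟩
    ∑ (range n) (λ N → ∑ (tuples k n) (λ Ms →
      q ^ tri N * I N * (q ^ (sumTri Ms) * chainᴿ a 1 (N ∷ Ms))))
      ≈⟨ ∑-cong (range n) (λ N → trans (sym (*-∑ (tuples k n) _ _)) (*-congˡ (∑-chain a k 1 N))) ⟩
    U (G a k 1) ∎

  G-suc : ∀ a k i {f} → (∀ M → G a k (suc i) M ≈ f M) → ∀ N → G a (suc k) i N ≈ T f (N ℕ.+ δ i a)
  G-suc a k i G≈f N = T-cong G≈f (N ℕ.+ δ i a)

  G-after : ∀ a k i → a < i → ∀ N → G a k i N ≈ fold 𝟙 T k N
  G-after a zero    i a<i N = refl
  G-after a (suc k) i a<i N = trans (G-suc a k i (G-after a k (suc i) (ℕ.m<n⇒m<1+n a<i)) N)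
    (reflexive (≡.cong (T (fold 𝟙 T k))
      (≡.trans (≡.cong (N ℕ.+_) (δ-distinct (ℕ.>⇒≢ a<i))) (ℕ.+-identityʳ N))))

  -- Induction on the distance d from place i to the shifted place a: each earlier factor
  -- contributes a plain T, the factor at a evaluates the rest at N + 1, and `G-after` handles the
  -- factors beyond.
  G-upTo : ∀ a b d i → d ℕ.+ i ≡ a →
    ∀ N → G a (d ℕ.+ suc b) i N ≈ fold (λ N → fold 𝟙 T (suc b) (suc N)) T d N
  G-upTo a b zero    i ≡.refl N = trans (G-suc a b a (G-after a b (suc a) (ℕ.n<1+n a)) N)
    (reflexive (≡.cong (fold 𝟙 T (suc b)) (≡.trans (≡.cong (N ℕ.+_) (δ-same a)) (ℕ.+-comm N 1))))
  G-upTo a b (suc d) i 1+d+i≡a N =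
    trans (G-suc a (d ℕ.+ suc b) i (G-upTo a b d (suc i) (≡.trans (ℕ.+-suc d i) 1+d+i≡a)) N)
      (reflexive (≡.cong (T _) (≡.trans (≡.cong (N ℕ.+_) (δ-distinct i≢a)) (ℕ.+-identityʳ N))))
    where
    i≢a : i ≢ a
    i≢a = ℕ.<⇒≢ (≡.subst (i <_) 1+d+i≡a (s≤s (ℕ.m≤n+m i d)))

  -- U consumes the first of the a + b + 2 variables. Of the others, a belong to factors before the
  -- shift and b + 1 to the shifted factor and those after it.
  ∑-term≈J : ∀ a b → ∑ (tuples (suc a ℕ.+ suc b) n) (termᴿ (suc a)) ≈ J a b
  ∑-term≈J a b = trans (∑-term (suc a) (a ℕ.+ suc b)) (U-cong (G-upTo (suc a) b a 1 (ℕ.+-comm a 1)))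

-- The ring of power series modulo q^(n+1)

sumTo-cong : ∀ n {f g : ℕ → ℤ} → (∀ k → k ≤ n → f k ≡ g k) → sumTo n f ≡ sumTo n g
sumTo-cong zero    f≡g = f≡g 0 z≤n
sumTo-cong (suc n) f≡g = ≡.cong₂ _+ℤ_
  (sumTo-cong n (λ k k≤n → f≡g k (ℕ.m≤n⇒m≤1+n k≤n))) (f≡g (suc n) ℕ.≤-refl)

sumTo-+ : ∀ n (f g : ℕ → ℤ) → sumTo n (λ k → f k +ℤ g k) ≡ sumTo n f +ℤ sumTo n g
sumTo-+ zero    f g = ≡.refl
sumTo-+ (suc n) f g rewrite sumTo-+ n f g =
  interchange (sumTo n f) (sumTo n g) (f (suc n)) (g (suc n))
  where
  interchange : ∀ a b c d → (a +ℤ b) +ℤ (c +ℤ d) ≡ (a +ℤ c) +ℤ (b +ℤ d)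
  interchange = ℤ.solve-∀

sumTo-* : ∀ n c (f : ℕ → ℤ) → sumTo n (λ k → c *ℤ f k) ≡ c *ℤ sumTo n f
sumTo-* zero    c f = ≡.refl
sumTo-* (suc n) c f rewrite sumTo-* n c f = ≡.sym (ℤ.*-distribˡ-+ c (sumTo n f) (f (suc n)))

sumTo-suc : ∀ n (f : ℕ → ℤ) → sumTo (suc n) f ≡ f 0 +ℤ sumTo n (λ k → f (suc k))
sumTo-suc zero    f = ≡.refl
sumTo-suc (suc n) f = ≡.trans (≡.cong (_+ℤ f (suc (suc n))) (sumTo-suc n f))
  (ℤ.+-assoc (f 0) (sumTo n (λ k → f (suc k))) (f (suc (suc n))))

_⊕_ : FPS → FPS → FPS
(f ⊕ g) i = f i +ℤ g i

⊖_ : FPS → FPS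
(⊖ f) i = -ℤ f i

-- The series (f - f(0))/q. Splitting f as f(0) + q `tail f` drives the inductions on degree below.
tail : FPS → FPS
tail f i = f (suc i)

-- Coefficients of a product up to degree n involve only coefficients of the factors up to degree n,
-- so truncated equality is compatible with multiplication.
⊛-cong : ∀ n {f f′ g g′ : FPS} → (∀ i → i ≤ n → f i ≡ f′ i) → (∀ i → i ≤ n → g i ≡ g′ i) →
         ∀ i → i ≤ n → (f ⊛ g) i ≡ (f′ ⊛ g′) i
⊛-cong n f≈f′ g≈g′ i i≤n = sumTo-cong i λ k k≤i → ≡.cong₂ _*ℤ_
  (f≈f′ k (ℕ.≤-trans k≤i i≤n)) (g≈g′ (i ℕ.∸ k) (ℕ.≤-trans (ℕ.m∸n≤m i k) i≤n))

⊛-sucˡ : ∀ f g i → (f ⊛ g) (suc i) ≡ f 0 *ℤ g (suc i) +ℤ (tail f ⊛ g) i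
⊛-sucˡ f g i = sumTo-suc i _

⊛-sucʳ : ∀ f g i → (f ⊛ g) (suc i) ≡ (f ⊛ tail g) i +ℤ f (suc i) *ℤ g 0
⊛-sucʳ f g i = ≡.cong₂ _+ℤ_
  (sumTo-cong i (λ k k≤i → ≡.cong (λ j → f k *ℤ g j) (ℕ.+-∸-assoc 1 k≤i)))
  (≡.cong (λ j → f (suc i) *ℤ g j) (ℕ.n∸n≡0 i))

⊛-comm : ∀ f g i → (f ⊛ g) i ≡ (g ⊛ f) i
⊛-comm f g zero    = ℤ.*-comm (f 0) (g 0)
⊛-comm f g (suc i) = begin
  (f ⊛ g) (suc i)                        ≡⟨ ⊛-sucˡ f g i ⟩
  f 0 *ℤ g (suc i) +ℤ (tail f ⊛ g) i     ≡⟨ ≡.cong₂ _+ℤ_ (ℤ.*-comm (f 0) (g (suc i))) (⊛-comm (tail f) g i) ⟩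
  g (suc i) *ℤ f 0 +ℤ (g ⊛ tail f) i     ≡⟨ ℤ.+-comm (g (suc i) *ℤ f 0) _ ⟩
  (g ⊛ tail f) i +ℤ g (suc i) *ℤ f 0     ≡⟨ ⊛-sucʳ g f i ⟨
  (g ⊛ f) (suc i)                        ∎
  where open ≡.≡-Reasoning

⊛-distribˡ : ∀ f g h i → (f ⊛ (g ⊕ h)) i ≡ (f ⊛ g) i +ℤ (f ⊛ h) i
⊛-distribˡ f g h i = ≡.trans
  (sumTo-cong i (λ k _ → ℤ.*-distribˡ-+ (f k) (g (i ℕ.∸ k)) (h (i ℕ.∸ k))))
  (sumTo-+ i _ _)

⊛-distribʳ : ∀ f g h i → ((g ⊕ h) ⊛ f) i ≡ (g ⊛ f) i +ℤ (h ⊛ f) i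
⊛-distribʳ f g h i = ≡.trans
  (sumTo-cong i (λ k _ → ℤ.*-distribʳ-+ (f (i ℕ.∸ k)) (g k) (h k)))
  (sumTo-+ i _ _)

⊛-scaleˡ : ∀ c f g i → ((λ k → c *ℤ f k) ⊛ g) i ≡ c *ℤ (f ⊛ g) i
⊛-scaleˡ c f g i = ≡.trans
  (sumTo-cong i (λ k _ → ℤ.*-assoc c (f k) (g (i ℕ.∸ k)))) (sumTo-* i c _)

-- Induction on the degree, using `tail (f ⊛ g)` = f(0) `tail g` + `tail f ⊛ g`.
⊛-assoc : ∀ f g h i → ((f ⊛ g) ⊛ h) i ≡ (f ⊛ (g ⊛ h)) i
⊛-assoc f g h zero    = ℤ.*-assoc (f 0) (g 0) (h 0)
⊛-assoc f g h (suc i) = begin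
  ((f ⊛ g) ⊛ h) (suc i)
    ≡⟨ ⊛-sucˡ (f ⊛ g) h i ⟩
  f 0 *ℤ g 0 *ℤ h (suc i) +ℤ (tail (f ⊛ g) ⊛ h) i
    ≡⟨ ≡.cong (f 0 *ℤ g 0 *ℤ h (suc i) +ℤ_)
         (⊛-cong i {g = h} (λ j _ → ⊛-sucˡ f g j) (λ _ _ → ≡.refl) i ℕ.≤-refl) ⟩
  f 0 *ℤ g 0 *ℤ h (suc i) +ℤ (((λ j → f 0 *ℤ tail g j) ⊕ (tail f ⊛ g)) ⊛ h) i
    ≡⟨ ≡.cong (f 0 *ℤ g 0 *ℤ h (suc i) +ℤ_)
         (⊛-distribʳ h (λ j → f 0 *ℤ tail g j) (tail f ⊛ g) i) ⟩
  f 0 *ℤ g 0 *ℤ h (suc i) +ℤ (((λ j → f 0 *ℤ tail g j) ⊛ h) i +ℤ ((tail f ⊛ g) ⊛ h) i)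
    ≡⟨ ≡.cong (f 0 *ℤ g 0 *ℤ h (suc i) +ℤ_)
         (≡.cong₂ _+ℤ_ (⊛-scaleˡ (f 0) (tail g) h i) (⊛-assoc (tail f) g h i)) ⟩
  f 0 *ℤ g 0 *ℤ h (suc i) +ℤ (f 0 *ℤ (tail g ⊛ h) i +ℤ (tail f ⊛ (g ⊛ h)) i)
    ≡⟨ regroup (f 0) (g 0) (h (suc i)) _ _ ⟩
  f 0 *ℤ (g 0 *ℤ h (suc i) +ℤ (tail g ⊛ h) i) +ℤ (tail f ⊛ (g ⊛ h)) i
    ≡⟨ ≡.cong (λ x → f 0 *ℤ x +ℤ (tail f ⊛ (g ⊛ h)) i) (⊛-sucˡ g h i) ⟨
  f 0 *ℤ (g ⊛ h) (suc i) +ℤ (tail f ⊛ (g ⊛ h)) i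
    ≡⟨ ⊛-sucˡ f (g ⊛ h) i ⟨
  (f ⊛ (g ⊛ h)) (suc i) ∎
  where
  open ≡.≡-Reasoning
  regroup : ∀ a b c x y → a *ℤ b *ℤ c +ℤ (a *ℤ x +ℤ y) ≡ a *ℤ (b *ℤ c +ℤ x) +ℤ y
  regroup = ℤ.solve-∀

⊛-zeroˡ : ∀ g i → (zeroS ⊛ g) i ≡ + 0
⊛-zeroˡ g zero    = ≡.refl
⊛-zeroˡ g (suc i) = ≡.trans (⊛-sucˡ zeroS g i) (≡.trans (ℤ.+-identityˡ _) (⊛-zeroˡ g i))

⊛-identityˡ : ∀ g i → (oneS ⊛ g) i ≡ g i
⊛-identityˡ g zero    = ℤ.*-identityˡ (g 0)
⊛-identityˡ g (suc i) = begin
  (oneS ⊛ g) (suc i)                   ≡⟨ ⊛-sucˡ oneS g i ⟩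
  + 1 *ℤ g (suc i) +ℤ (zeroS ⊛ g) i    ≡⟨ ≡.cong₂ _+ℤ_ (ℤ.*-identityˡ (g (suc i))) (⊛-zeroˡ g i) ⟩
  g (suc i) +ℤ + 0                     ≡⟨ ℤ.+-identityʳ _ ⟩
  g (suc i)                            ∎
  where open ≡.≡-Reasoning

qpow-suc : ∀ e i → (qpow 1 ⊛ qpow e) i ≡ qpow (suc e) i
qpow-suc e zero    = ≡.refl
qpow-suc e (suc i) = begin
  (qpow 1 ⊛ qpow e) (suc i)           ≡⟨ ⊛-sucˡ (qpow 1) (qpow e) i ⟩
  + 0 +ℤ (oneS ⊛ qpow e) i            ≡⟨ ℤ.+-identityˡ _ ⟩
  (oneS ⊛ qpow e) i                   ≡⟨ ⊛-identityˡ (qpow e) i ⟩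
  qpow e i                            ∎
  where open ≡.≡-Reasoning

qpow-off : ∀ {e i} → i ≢ e → qpow e i ≡ + 0
qpow-off {e} {i} i≢e rewrite dec-false (i ≟ e) i≢e = ≡.refl

-- Each stage of the table adds one entry and leaves the earlier ones unchanged.
invUpTo-stable : ∀ a {n k} → k ≤ n → invUpTo a n k ≡ inv a k
invUpTo-stable a {zero}  z≤n = ≡.refl
invUpTo-stable a {suc n} {k} k≤1+n with ℕ.m≤n⇒m<n∨m≡n k≤1+n
... | inj₂ ≡.refl = ≡.refl
... | inj₁ (s≤s k≤n) rewrite dec-true (k ≤? n) k≤n = invUpTo-stable a k≤n

inv-suc : ∀ a n → inv a (suc n) ≡ -ℤ sumTo n (λ i → inv a i *ℤ a (suc n ℕ.∸ i))
inv-suc a n rewrite dec-false (suc n ≤? n) ℕ.1+n≰n = ≡.cong -ℤ_ (sumTo-cong n λ i i≤n →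
  ≡.trans (≡.cong (a (suc n ℕ.∸ i) *ℤ_) (invUpTo-stable a i≤n)) (ℤ.*-comm (a (suc n ℕ.∸ i)) (inv a i)))

-- The recursion defines the newest coefficient of the inverse as minus the sum of the other terms
-- of the convolution; it is multiplied by a(0) = 1, so the total is 0.
inv-inverseˡ : ∀ a → a 0 ≡ + 1 → ∀ i → (inv a ⊛ a) i ≡ oneS i
inv-inverseˡ a a0≡1 zero    rewrite a0≡1 = ≡.refl
inv-inverseˡ a a0≡1 (suc n) = begin
  s +ℤ inv a (suc n) *ℤ a (n ℕ.∸ n)
    ≡⟨ ≡.cong (λ x → s +ℤ inv a (suc n) *ℤ x) (≡.trans (≡.cong a (ℕ.n∸n≡0 n)) a0≡1) ⟩
  s +ℤ inv a (suc n) *ℤ + 1     ≡⟨ ≡.cong (s +ℤ_) (ℤ.*-identityʳ _) ⟩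
  s +ℤ inv a (suc n)            ≡⟨ ≡.cong (s +ℤ_) (inv-suc a n) ⟩
  s +ℤ -ℤ s                      ≡⟨ ℤ.+-inverseʳ s ⟩
  + 0                           ∎
  where
  open ≡.≡-Reasoning
  s = sumTo n (λ i → inv a i *ℤ a (suc n ℕ.∸ i))

qPoch-zero : ∀ j → qPoch j 0 ≡ + 1
qPoch-zero zero    = ≡.refl
qPoch-zero (suc j) rewrite qPoch-zero j = ≡.refl

-- The quotient by q^(n+1) is taken in the equality alone: elements and operations are those of full
-- power series, and two series are equal when they agree up to degree n.
truncated : ℕ → CommutativeRing 0ℓ 0ℓ
truncated n = record
  { Carrier = FPS
  ; _≈_ = λ f g → ∀ i → i ≤ n → f i ≡ g i
  ; _+_ = _⊕_
  ; _*_ = _⊛_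
  ; -_ = ⊖_
  ; 0# = zeroS
  ; 1# = oneS
  ; isCommutativeRing = record
    { isRing = record
      { +-isAbelianGroup = record
        { isGroup = record
          { isMonoid = record
            { isSemigroup = record
              { isMagma = record
                { isEquivalence = record
                  { refl = λ _ _ → ≡.refl
                  ; sym = λ f≈g i i≤n → ≡.sym (f≈g i i≤n)
                  ; trans = λ f≈g g≈h i i≤n → ≡.trans (f≈g i i≤n) (g≈h i i≤n)
                  }
                ; ∙-cong = λ f≈f′ g≈g′ i i≤n → ≡.cong₂ _+ℤ_ (f≈f′ i i≤n) (g≈g′ i i≤n)
                }
              ; assoc = λ f g h i _ → ℤ.+-assoc (f i) (g i) (h i)
              }
            ; identity = (λ f i _ → ℤ.+-identityˡ (f i)) , (λ f i _ → ℤ.+-identityʳ (f i))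
            }
          ; inverse = (λ f i _ → ℤ.+-inverseˡ (f i)) , (λ f i _ → ℤ.+-inverseʳ (f i))
          ; ⁻¹-cong = λ f≈g i i≤n → ≡.cong -ℤ_ (f≈g i i≤n)
          }
        ; comm = λ f g i _ → ℤ.+-comm (f i) (g i)
        }
      ; *-cong = ⊛-cong n
      ; *-assoc = λ f g h i _ → ⊛-assoc f g h i
      ; *-identity = (λ f i _ → ⊛-identityˡ f i) ,
                     (λ f i _ → ≡.trans (⊛-comm f oneS i) (⊛-identityˡ f i))
      ; distrib = (λ f g h i _ → ⊛-distribˡ f g h i) , (λ f g h i _ → ⊛-distribʳ f g h i)
      }
    ; *-comm = λ f g i _ → ⊛-comm f g i
    }
  }

qbin-≤ : ∀ {N M} → M ≤ N → qbin N M ≡ qPoch N ⊛ inv (qPoch M) ⊛ inv (qPoch (N ℕ.∸ M))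
qbin-≤ {N} {M} M≤N rewrite dec-true (M ≤? N) M≤N = ≡.refl

qbin-> : ∀ {N M} → N < M → qbin N M ≡ zeroS
qbin-> {N} {M} N<M rewrite dec-false (M ≤? N) (ℕ.<⇒≱ N<M) = ≡.refl

-- Specialisation to integer power series modulo q^(n+1)

module Truncated (n : ℕ) where
  R : CommutativeRing 0ℓ 0ℓ
  R = truncated n
  open CommutativeRing R using (_≈_; reflexive; semiring)
  open Exp semiring
  open ListSum R

  q : FPS
  q = qpow 1

  q^≈qpow : ∀ e → q ^ e ≈ qpow e
  q^≈qpow zero    i i≤n = ≡.refl
  q^≈qpow (suc e) i i≤n = ≡.trans
    (⊛-cong n {q} {q} {q ^ e} {qpow e} (λ _ _ → ≡.refl) (q^≈qpow e) i i≤n) (qpow-suc e i)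

  Q : QStructure R n
  Q = record
    { q          = q
    ; q^1+n≈0    = λ i i≤n → ≡.trans (q^≈qpow (suc n) i i≤n) (qpow-off (ℕ.<⇒≢ (s≤s i≤n)))
    ; poch       = qPoch
    ; poch-zero  = λ _ _ → ≡.refl
    ; poch-suc   = λ j → ⊛-cong n {qPoch j} (λ _ _ → ≡.refl)
        (λ i i≤n → ≡.cong (λ x → oneS i +ℤ -ℤ x) (≡.sym (q^≈qpow (suc j) i i≤n)))
    ; I          = λ j → inv (qPoch j)
    ; I-inverseˡ = λ j i _ → inv-inverseˡ (qPoch j) (qPoch-zero j) i
    ; B          = qbin
    ; B-≤        = λ M≤N → reflexive (qbin-≤ M≤N)
    ; B->        = λ N<M → reflexive (qbin-> N<M)
    }

  open Reversal R n Q

  ∑-coefficient : ∀ {A : Set} (xs : List A) (f : A → FPS) i →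
    foldr _+ℤ_ (+ 0) (map (λ x → f x i) xs) ≡ ∑ xs f i
  ∑-coefficient []       f i = ≡.refl
  ∑-coefficient (x ∷ xs) f i = ≡.cong (f x i +ℤ_) (∑-coefficient xs f i)

  chain≡chainᴿ : ∀ {k} a i (N : Vec ℕ k) → chain a i N ≡ chainᴿ a i N
  chain≡chainᴿ a i []             = ≡.refl
  chain≡chainᴿ a i (x ∷ [])       = ≡.refl
  chain≡chainᴿ a i (x ∷ y ∷ rest) = ≡.cong (qbin (x ℕ.+ δ i a) y ⊛_) (chain≡chainᴿ a (suc i) (y ∷ rest))

  term≈termᴿ : ∀ {k} a (N : Vec ℕ (suc k)) → term a N ≈ termᴿ a N
  term≈termᴿ a N@(x ∷ _) = ⊛-cong n
    {qpow (sumTri N) ⊛ inv (qPoch x)} {q ^ sumTri N ⊛ inv (qPoch x)}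
    (⊛-cong n {qpow (sumTri N)} {q ^ sumTri N} {inv (qPoch x)}
      (λ i i≤n → ≡.sym (q^≈qpow (sumTri N) i i≤n)) (λ _ _ → ≡.refl))
    (λ i _ → ≡.cong (λ f → f i) (chain≡chainᴿ a 1 N))

  -- Coefficient n of `S` sums over tuples with entries at most n, the same bound as in `T` and `U`,
  -- and it is the last coefficient that equality modulo q^(n+1) controls.
  S≡J : ∀ a b → S (suc a ℕ.+ suc b) (suc a) n ≡ J a b n
  S≡J a b = begin
    S m (suc a) n                      ≡⟨ ∑-coefficient (tuples m n) (term (suc a)) n ⟩
    ∑ (tuples m n) (term (suc a)) n    ≡⟨ ∑-cong (tuples m n) (term≈termᴿ (suc a)) n ℕ.≤-refl ⟩
    ∑ (tuples m n) (termᴿ (suc a)) n   ≡⟨ ∑-term≈J a b n ℕ.≤-refl ⟩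
    J a b n                            ∎
    where
    open ≡.≡-Reasoning
    m = suc a ℕ.+ suc b

  S-reversal : ∀ a b → S (suc a ℕ.+ suc b) (suc a) n ≡ S (suc a ℕ.+ suc b) (suc b) n
  S-reversal a b = ≡.trans (S≡J a b) (≡.trans (J-sym a b n ℕ.≤-refl)
    (≡.trans (≡.sym (S≡J b a)) (≡.cong (λ m → S m (suc b) n) (ℕ.+-comm (suc b) (suc a)))))

theorem5p4 : (m a : ℕ) → 1 ≤ m → 1 ≤ a → a ≤ m ∸ 1 →
    (n : ℕ) → S m a n ≡ S m (m ∸ a) n
theorem5p4 (suc m) (suc a) _ _ a<m n = ≡.subst₂
  (λ m b → S m (suc a) n ≡ S m b n)
  (≡.trans (ℕ.+-comm (suc a) (suc b)) (≡.cong suc (ℕ.m∸n+n≡m a<m))) (≡.sym (ℕ.+-∸-assoc 1 a<m))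
  (Truncated.S-reversal n a b)
  -- This choice writes the number of variables `suc m` as (a + 1) + (b + 1), so that b + 1 is the
  -- complementary place.
  where b = m ℕ.∸ suc a
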